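{- Let $w\in S_n$ and $\mathcal P\in\mathsf{Pipes}(w)$. Then $\mathcal P$ has a crossing tile in $\mathbb Y(\lambda^{(w)})$ if and only if $w$ is not vexillary. Furthermore, if $w$ is vexillary then $\mathsf{RPipes}(w)=\mathsf{Pipes}(w)$.
   Context: A permutation $w\in S_n$ is vexillary if there are no $i_1<i_2<i_3<i_4$ with $w_{i_2}<w_{i_1}<w_{i_4}<w_{i_3}$ (it avoids $2143$). Bumpless pipe dreams. Cells $(i,j)$ of the $n\times n$ grid: row $i$ from the top, column $j$ from the left. There are six tiles: downward elbow (a pipe joining the bottom and right edges), upward elbow (a pipe joining the left and top edges), crossing (one pipe joining left and right edges and one joining bottom and top edges), blank (no pipe), horizontal (left to right), vertical (bottom to top). A bumpless pipe dream (BPD) of size $n$ is a tiling of the grid by these tiles such that an edge shared by two cells is met by a pipe from both sides or from neither, every bottom and right boundary edge is met by a pipe, and no left or top boundary edge is met by a pipe. So there are $n$ pipes, running from the bottom boundary to the right boundary. A BPD is reduced if every pair of pipes crosses at most once. Demazure product $\partial(\mathcal P)\in S_n$: label the bottom boundary edges $1,\dots,n$ from left to right and propagate labels along pipes north and east; at a crossing tile, of the two labels entering from the left and from below, the smaller leaves through the right edge and the larger through the top edge. $\partial(\mathcal P)(i)$ is the label arriving at the right boundary edge of row $i$. $\mathsf{Pipes}(w)=\{\mathcal P:\partial(\mathcal P)=w\}$ and $\mathsf{RPipes}(w)=\{\mathcal P\in\mathsf{Pipes}(w):\mathcal P\text{ is reduced}\}$. The Rothe diagram is $D(w)=\{(i,j):w_i>j,\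 w^{ -1}(j)>i\}$. $\lambda^{(w)}$ is the partition whose diagram is $\mathbb Y(\lambda^{(w)})=\bigcup_{(i,j)\in D(w)}[1,i]\times[1,j]$, where $\mathbb Y(\lambda)=\{(i,j):1\le j\le\lambda_i\}$. -}

module Defs where

open import Algebra.Construct.NaturalChoice.Max as Max using ()
open import Algebra.Construct.NaturalChoice.Min as Min using ()
open import Data.Bool.Base using (Bool; true; false)
open import Data.Fin.Base using (Fin; toℕ; _<_; _≤_)
open import Data.Fin.Permutation using (Permutation′; _⟨$⟩ʳ_; _⟨$⟩ˡ_)
open import Data.Fin.Properties using (≤-totalOrder)
open import Data.Nat.Base using (ℕ; suc)
open import Data.Product.Base using (_×_; _,_; proj₁; proj₂; ∃-syntax)
open import Data.Sum.Base using (_⊎_)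
open import Level using (0ℓ)
open import Relation.Binary.PropositionalEquality.Core using (_≡_; _≢_)
open import Relation.Nullary.Negation.Core using (¬_)
open import Relation.Unary using (Pred; _∩_)

-- Everything is indexed from 0: rows, columns and pipe labels in [1,n] are
-- represented by Fin n.  The first argument is always the row (row 0 on top),
-- the second the column (column 0 on the left).

Cell : ℕ → Set
Cell n = Fin n × Fin n

-- Permutations, in one-line notation w i = w ⟨$⟩ʳ i.

Contains2143 : {n : ℕ} → Pred (Permutation′ n) 0ℓ
Contains2143 w = ∃[ i₁ ] ∃[ i₂ ] ∃[ i₃ ] ∃[ i₄ ]
  (i₁ < i₂ × i₂ < i₃ × i₃ < i₄ ×
   w ⟨$⟩ʳ i₂ < w ⟨$⟩ʳ i₁ × w ⟨$⟩ʳ i₁ < w ⟨$⟩ʳ i₄ × w ⟨$⟩ʳ i₄ < w ⟨$⟩ʳ i₃)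

Vexillary : {n : ℕ} → Pred (Permutation′ n) 0ℓ
Vexillary w = ¬ Contains2143 w

RotheDiagram : {n : ℕ} → Permutation′ n → Pred (Cell n) 0ℓ
RotheDiagram w (i , j) = j < w ⟨$⟩ʳ i × i < w ⟨$⟩ˡ j

-- The Young diagram of λ^(w).  The partition λ^(w) is specified only through
-- its diagram, the union of the rectangles [1,a] × [1,b] over (a , b) in the
-- Rothe diagram; this is that union, which lies inside the n × n grid.

𝕐λ : {n : ℕ} → Permutation′ n → Pred (Cell n) 0ℓ
𝕐λ w (i , j) = ∃[ a ] ∃[ b ] (RotheDiagram w (a , b) × i ≤ a × j ≤ b)

data Tile : Set where
  downElbow  : Tile   -- joins bottom and right
  upElbow    : Tile   -- joins left and top
  crossing   : Tile
  blank      : Tile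
  horizontal : Tile
  vertical   : Tile

-- Whether a pipe of the tile meets the given edge of its cell.

left right top bottom : Tile → Bool

left downElbow  = false
left upElbow    = true
left crossing   = true
left blank      = false
left horizontal = true
left vertical   = false

right downElbow  = true
right upElbow    = false
right crossing   = true
right blank      = false
right horizontal = true
right vertical   = false

top downElbow  = false
top upElbow    = true
top crossing   = true
top blank      = false
top horizontal = false
top vertical   = true

bottom downElbow  = true
bottom upElbow    = false
bottom crossing   = true
bottom blank      = false
bottom horizontal = false
bottom vertical   = true

-- k′ is the index immediately after k (to the right of it, or below it).

Next : {n : ℕ} → Fin n → Fin n → Set
Next k k′ = toℕ k′ ≡ suc (toℕ k)

First Last : {n : ℕ} → Fin n → Set
First k = toℕ k ≡ 0
Last {n} k = suc (toℕ k) ≡ n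

record BPD (n : ℕ) : Set where
  field
    tile        : Fin n → Fin n → Tile
    matchRow    : ∀ i {j j′} → Next j j′ → right (tile i j) ≡ left (tile i j′)
    matchColumn : ∀ {i i′} j → Next i i′ → bottom (tile i j) ≡ top (tile i′ j)
    bottomEdge  : ∀ {i} j → Last i → bottom (tile i j) ≡ true
    rightEdge   : ∀ i {j} → Last j → right (tile i j) ≡ true
    leftEdge    : ∀ i {j} → First j → left (tile i j) ≡ false
    topEdge     : ∀ {i} j → First i → top (tile i j) ≡ false

open BPD public using (tile)

-- A crossing rule sends the labels entering a crossing tile
-- (from the left , from below) to those leaving it
-- (through the right edge , through the top edge).

CrossingRule : ℕ → Set
CrossingRule n = Fin n → Fin n → Fin n × Fin n

-- Each pipe goes straight through: labels follow the actual pipes.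
straight : {n : ℕ} → CrossingRule n
straight a b = a , b

demazure : {n : ℕ} → CrossingRule n
demazure {n} a b = Min._⊓_ (≤-totalOrder n) a b , Max._⊔_ (≤-totalOrder n) a b

-- Propagation of labels north and east from the bottom boundary, where the
-- edge in column j has label j.  The four relations say which label is
-- carried by the given edge of the cell (i , j).

module Propagation {n : ℕ} (𝒫 : BPD n) (rule : CrossingRule n) where

  data EntersLeft   : (i j label : Fin n) → Set
  data EntersBottom : (i j label : Fin n) → Set
  data LeavesRight  : (i j label : Fin n) → Set
  data LeavesTop    : (i j label : Fin n) → Set

  data EntersLeft where
    fromLeft : ∀ {i j j′ a} → Next j j′ → LeavesRight i j a → EntersLeft i j′ a

  data EntersBottom where
    boundary  : ∀ {i j} → Last i → EntersBottom i j j
    fromBelow : ∀ {i i′ j a} → Next i i′ → LeavesTop i′ j a → EntersBottom i j a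

  data LeavesRight where
    viaHorizontal : ∀ {i j a} → tile 𝒫 i j ≡ horizontal →
                    EntersLeft i j a → LeavesRight i j a
    viaDownElbow  : ∀ {i j a} → tile 𝒫 i j ≡ downElbow →
                    EntersBottom i j a → LeavesRight i j a
    viaCrossing   : ∀ {i j a b} → tile 𝒫 i j ≡ crossing →
                    EntersLeft i j a → EntersBottom i j b →
                    LeavesRight i j (proj₁ (rule a b))

  data LeavesTop where
    viaVertical : ∀ {i j a} → tile 𝒫 i j ≡ vertical →
                  EntersBottom i j a → LeavesTop i j a
    viaUpElbow  : ∀ {i j a} → tile 𝒫 i j ≡ upElbow →
                  EntersLeft i j a → LeavesTop i j a
    viaCrossing : ∀ {i j a b} → tile 𝒫 i j ≡ crossing →
                  EntersLeft i j a → EntersBottom i j b →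
                  LeavesTop i j (proj₂ (rule a b))

-- Pipes are named by the column in which they start on the bottom boundary.

PipesCrossAt : {n : ℕ} → BPD n → Fin n → Fin n → Cell n → Set
PipesCrossAt 𝒫 p q (i , j) =
  tile 𝒫 i j ≡ crossing ×
  ((EntersLeft i j p × EntersBottom i j q) ⊎
   (EntersLeft i j q × EntersBottom i j p))
  where open Propagation 𝒫 straight

Reduced : {n : ℕ} → Pred (BPD n) 0ℓ
Reduced 𝒫 = ∀ p q → p ≢ q →
  ∀ c c′ → PipesCrossAt 𝒫 p q c → PipesCrossAt 𝒫 p q c′ → c ≡ c′

-- ∂ 𝒫 ⟦ i ⟧= a is the graph of the Demazure product: a is the label
-- arriving at the right boundary edge of row i.

∂_⟦_⟧=_ : {n : ℕ} → BPD n → Fin n → Fin n → Set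
∂ 𝒫 ⟦ i ⟧= a = ∃[ j ] (Last j × Propagation.LeavesRight 𝒫 demazure i j a)

Pipes : {n : ℕ} → Permutation′ n → Pred (BPD n) 0ℓ
Pipes w 𝒫 = ∀ i → ∂ 𝒫 ⟦ i ⟧= (w ⟨$⟩ʳ i)

RPipes : {n : ℕ} → Permutation′ n → Pred (BPD n) 0ℓ
RPipes w = Pipes w ∩ Reduced

HasCrossingIn : {n : ℕ} → BPD n → Pred (Cell n) 0ℓ → Set
HasCrossingIn 𝒫 S = ∃[ i ] ∃[ j ] (S (i , j) × tile 𝒫 i j ≡ crossing)

{-# OPTIONS --safe #-}
module Submission where

-- At a crossing the larger label leaves on top of the smaller one, and two
-- labels in this position can never pass each other again, so the larger one
-- exits strictly above.  A crossing weakly north-west of a cell (a , b) of the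
-- Rothe diagram therefore produces the "21" of a 2143 pattern whose "43" is
-- (a , w a), (w⁻¹ b , b).
--
-- Outside 𝕐λ w, a region closed under moving south-east and free of diagram
-- cells, 𝒫 is forced, from the south-east corner on, to coincide with the
-- Rothe bumpless pipe dream: a crossing there at (i , j) is entered by w i from
-- the left and by j from below, with w i < j.  Conversely, the labels of the
-- "21" of a 2143 pattern have to swap, and if they did so outside 𝕐λ w it would
-- be at a cell that the "43" puts inside 𝕐λ w.  For vexillary w all crossings
-- are outside, so no pipe bounces and the two labels determine the cell.

open import Defs
open import Data.Nat.Base using (ℕ)
open import Data.Fin.Permutation using (Permutation′)
open import Data.Product.Base using (_×_)
open import Function.Bundles using (_⇔_)
open import Relation.Nullary.Negation.Core using (¬_)
open import Relation.Unary using (_∈_; _≐_)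

open import Data.Bool.Base using (Bool; true; false)
open import Data.Fin.Base using (Fin; toℕ; fromℕ<; _<_; _≤_; _>_)
open import Data.Fin.Induction using (<-wellFounded; >-wellFounded)
open import Data.Fin.Permutation using (_⟨$⟩ʳ_; _⟨$⟩ˡ_; inverseˡ; inverseʳ)
open import Data.Fin.Properties
  using (≤-totalOrder; ≤-total; _<?_; _≤?_; any?; toℕ-injective; toℕ-fromℕ<; toℕ<n)
open import Data.Nat.Base using (suc; s≤s; s≤s⁻¹)
import Data.Nat.Base as ℕ
import Data.Nat.Properties as ℕ
open import Data.Product.Base using (_,_; proj₁; proj₂; ∃; ∃-syntax; map₂)
open import Data.Sum.Base using (_⊎_; inj₁; inj₂) renaming (map₁ to ⊎-map₁)
open import Function.Base using (_∘_)
open import Function.Bundles using (mk⇔; Equivalence)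
open import Induction.WellFounded using (Acc; acc)
open import Relation.Binary.PropositionalEquality
  using (_≡_; _≢_; refl; sym; trans; cong; cong₂; subst; subst₂)
open import Relation.Nullary.Decidable using (yes; no; _×-dec_; decidable-stable)
open import Relation.Nullary.Negation using (contradiction)
open import Relation.Unary using (Decidable)

module Min {n : ℕ} where
  open import Algebra.Construct.NaturalChoice.Min (≤-totalOrder n) public

module Max {n : ℕ} where
  open import Algebra.Construct.NaturalChoice.Max (≤-totalOrder n) public

open Min using (_⊓_)
open Max using (_⊔_)

-- Tiles meeting a given edge

left⁻¹ : ∀ {t} → left t ≡ true → t ≡ horizontal ⊎ t ≡ upElbow ⊎ t ≡ crossing
left⁻¹ {horizontal} refl = inj₁ refl
left⁻¹ {upElbow}    refl = inj₂ (inj₁ refl)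
left⁻¹ {crossing}   refl = inj₂ (inj₂ refl)

right⁻¹ : ∀ {t} → right t ≡ true → t ≡ horizontal ⊎ t ≡ downElbow ⊎ t ≡ crossing
right⁻¹ {horizontal} refl = inj₁ refl
right⁻¹ {downElbow}  refl = inj₂ (inj₁ refl)
right⁻¹ {crossing}   refl = inj₂ (inj₂ refl)

top⁻¹ : ∀ {t} → top t ≡ true → t ≡ vertical ⊎ t ≡ upElbow ⊎ t ≡ crossing
top⁻¹ {vertical} refl = inj₁ refl
top⁻¹ {upElbow}  refl = inj₂ (inj₁ refl)
top⁻¹ {crossing} refl = inj₂ (inj₂ refl)

bottom⁻¹ : ∀ {t} → bottom t ≡ true → t ≡ vertical ⊎ t ≡ downElbow ⊎ t ≡ crossing
bottom⁻¹ {vertical}  refl = inj₁ refl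
bottom⁻¹ {downElbow} refl = inj₂ (inj₁ refl)
bottom⁻¹ {crossing}  refl = inj₂ (inj₂ refl)

left∧bottom⇒crossing : ∀ {t} → left t ≡ true → bottom t ≡ true → t ≡ crossing
left∧bottom⇒crossing {crossing} refl refl = refl

true≢false : ∀ {b : Bool} → b ≡ true → b ≢ false
true≢false refl ()

-- Neighbouring and extreme indices

module _ {n : ℕ} where

  Next⇒< : ∀ {k k′ : Fin n} → Next k k′ → k < k′
  Next⇒< nx = ℕ.≤-reflexive (sym nx)

  Next-injective : ∀ {k₁ k₂ k′ : Fin n} → Next k₁ k′ → Next k₂ k′ → k₁ ≡ k₂
  Next-injective nx₁ nx₂ = toℕ-injective (ℕ.suc-injective (trans (sym nx₁) nx₂))

  Last⇒¬Next : ∀ {k k′ : Fin n} → Last k → ¬ Next k k′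
  Last⇒¬Next {k′ = k′} l nx = ℕ.<-irrefl (trans nx l) (toℕ<n k′)

  Last-unique : ∀ {k₁ k₂ : Fin n} → Last k₁ → Last k₂ → k₁ ≡ k₂
  Last-unique l₁ l₂ = toℕ-injective (ℕ.suc-injective (trans l₁ (sym l₂)))

  last⊎next : ∀ (k : Fin n) → Last k ⊎ ∃ (Next k)
  last⊎next k with ℕ.m≤n⇒m<n∨m≡n (toℕ<n k)
  ... | inj₁ 1+k<n = inj₂ (fromℕ< 1+k<n , toℕ-fromℕ< 1+k<n)
  ... | inj₂ 1+k≡n = inj₁ 1+k≡n

  first⊎prev : ∀ (k : Fin n) → First k ⊎ ∃[ k₀ ] Next k₀ k
  first⊎prev Fin.zero    = inj₁ refl
  first⊎prev (Fin.suc k) =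
    inj₂ (fromℕ< k<n , cong suc (sym (toℕ-fromℕ< k<n)))
    where k<n = ℕ.m<n⇒m<1+n (toℕ<n k)

  some-last : Fin n → ∃ (Last {n})
  some-last (Fin.zero {m})  = fromℕ< (ℕ.n<1+n m) , cong suc (toℕ-fromℕ< (ℕ.n<1+n m))
  some-last (Fin.suc {m} _) = fromℕ< (ℕ.n<1+n m) , cong suc (toℕ-fromℕ< (ℕ.n<1+n m))

  Last⇒maximum : ∀ {k k′ : Fin n} → Last k → k′ ≤ k
  Last⇒maximum {k′ = k′} l = s≤s⁻¹ (subst (toℕ k′ ℕ.<_) (sym l) (toℕ<n k′))

-- Existence and uniqueness of Demazure labels

module _ {n : ℕ} (𝒫 : BPD n) where
  open BPD 𝒫 hiding (tile)

  module Edges {rule : CrossingRule n} where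
    open Propagation 𝒫 rule

    leavesRight⇒right : ∀ {i j a} → LeavesRight i j a → right (tile 𝒫 i j) ≡ true
    leavesRight⇒right (viaHorizontal t _)   = cong right t
    leavesRight⇒right (viaDownElbow t _)    = cong right t
    leavesRight⇒right (viaCrossing t _ _) = cong right t

    leavesTop⇒top : ∀ {i j a} → LeavesTop i j a → top (tile 𝒫 i j) ≡ true
    leavesTop⇒top (viaVertical t _)   = cong top t
    leavesTop⇒top (viaUpElbow t _)    = cong top t
    leavesTop⇒top (viaCrossing t _ _) = cong top t

    entersLeft⇒left : ∀ {i j a} → EntersLeft i j a → left (tile 𝒫 i j) ≡ true
    entersLeft⇒left {i} (fromLeft nx r) = trans (sym (matchRow i nx)) (leavesRight⇒right r)

    entersBottom⇒bottom : ∀ {i j a} → EntersBottom i j a → bottom (tile 𝒫 i j) ≡ true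
    entersBottom⇒bottom {i} {j} (boundary l)     = bottomEdge j l
    entersBottom⇒bottom {i} {j} (fromBelow nx u) = trans (matchColumn j nx) (leavesTop⇒top u)

  open Edges
  open Propagation 𝒫 demazure

  mutual
    -- Tracing a label back leads west or south, hence the recursion to smaller columns and larger
    -- rows. No pipe meets the left boundary, so the trace ends on the bottom boundary.
    entersLeft-exists : ∀ {i j} → Acc _>_ i → Acc _<_ j →
                        left (tile 𝒫 i j) ≡ true → ∃ (EntersLeft i j)
    entersLeft-exists {i} {j} ai (acc rj) l with first⊎prev j
    ... | inj₁ f         = contradiction (leftEdge i f) (true≢false l)
    ... | inj₂ (j₀ , nx) = map₂ (fromLeft nx)
      (leavesRight-exists ai (rj (Next⇒< nx)) (trans (matchRow i nx) l))

    entersBottom-exists : ∀ {i j} → Acc _>_ i → Acc _<_ j →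
                          bottom (tile 𝒫 i j) ≡ true → ∃ (EntersBottom i j)
    entersBottom-exists {i} {j} (acc ri) aj b with last⊎next i
    ... | inj₁ l         = j , boundary l
    ... | inj₂ (i′ , nx) = map₂ (fromBelow nx)
      (leavesTop-exists (ri (Next⇒< nx)) aj (trans (sym (matchColumn j nx)) b))

    leavesRight-exists : ∀ {i j} → Acc _>_ i → Acc _<_ j →
                         right (tile 𝒫 i j) ≡ true → ∃ (LeavesRight i j)
    leavesRight-exists ai aj r with right⁻¹ r
    ... | inj₁ t        = map₂ (viaHorizontal t) (entersLeft-exists ai aj (cong left t))
    ... | inj₂ (inj₁ t) = map₂ (viaDownElbow t) (entersBottom-exists ai aj (cong bottom t))
    ... | inj₂ (inj₂ t) = _ , viaCrossing t
      (proj₂ (entersLeft-exists ai aj (cong left t)))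
      (proj₂ (entersBottom-exists ai aj (cong bottom t)))

    leavesTop-exists : ∀ {i j} → Acc _>_ i → Acc _<_ j →
                       top (tile 𝒫 i j) ≡ true → ∃ (LeavesTop i j)
    leavesTop-exists ai aj u with top⁻¹ u
    ... | inj₁ t        = map₂ (viaVertical t) (entersBottom-exists ai aj (cong bottom t))
    ... | inj₂ (inj₁ t) = map₂ (viaUpElbow t) (entersLeft-exists ai aj (cong left t))
    ... | inj₂ (inj₂ t) = _ , viaCrossing t
      (proj₂ (entersLeft-exists ai aj (cong left t)))
      (proj₂ (entersBottom-exists ai aj (cong bottom t)))

  labelLeft : ∀ {i j} → left (tile 𝒫 i j) ≡ true → ∃ (EntersLeft i j)
  labelLeft = entersLeft-exists (>-wellFounded _) (<-wellFounded _)

  labelBelow : ∀ {i j} → bottom (tile 𝒫 i j) ≡ true → ∃ (EntersBottom i j)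
  labelBelow = entersBottom-exists (>-wellFounded _) (<-wellFounded _)

  mutual
    entersLeft-unique : ∀ {i j a b} → EntersLeft i j a → EntersLeft i j b → a ≡ b
    entersLeft-unique (fromLeft nx r) (fromLeft nx′ r′) with Next-injective nx nx′
    ... | refl = leavesRight-unique r r′

    entersBottom-unique : ∀ {i j a b} → EntersBottom i j a → EntersBottom i j b → a ≡ b
    entersBottom-unique (boundary _)     (boundary _)       = refl
    entersBottom-unique (boundary l)     (fromBelow nx _)   = contradiction nx (Last⇒¬Next l)
    entersBottom-unique (fromBelow nx _) (boundary l)       = contradiction nx (Last⇒¬Next l)
    entersBottom-unique (fromBelow nx u) (fromBelow nx′ u′)
      with toℕ-injective (trans nx (sym nx′))
    ... | refl = leavesTop-unique u u′

    leavesRight-unique : ∀ {i j a b} → LeavesRight i j a → LeavesRight i j b → a ≡ b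
    leavesRight-unique (viaHorizontal _ l) (viaHorizontal _ l′) = entersLeft-unique l l′
    leavesRight-unique (viaDownElbow _ b) (viaDownElbow _ b′) = entersBottom-unique b b′
    leavesRight-unique (viaCrossing _ l b) (viaCrossing _ l′ b′) =
      cong₂ _⊓_ (entersLeft-unique l l′) (entersBottom-unique b b′)
    leavesRight-unique (viaHorizontal t _) (viaDownElbow t′ _) with () ← trans (sym t) t′
    leavesRight-unique (viaHorizontal t _) (viaCrossing t′ _ _) with () ← trans (sym t) t′
    leavesRight-unique (viaDownElbow t _) (viaHorizontal t′ _) with () ← trans (sym t) t′
    leavesRight-unique (viaDownElbow t _) (viaCrossing t′ _ _) with () ← trans (sym t) t′
    leavesRight-unique (viaCrossing t _ _) (viaHorizontal t′ _) with () ← trans (sym t) t′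
    leavesRight-unique (viaCrossing t _ _) (viaDownElbow t′ _) with () ← trans (sym t) t′

    leavesTop-unique : ∀ {i j a b} → LeavesTop i j a → LeavesTop i j b → a ≡ b
    leavesTop-unique (viaVertical _ b) (viaVertical _ b′) = entersBottom-unique b b′
    leavesTop-unique (viaUpElbow _ l) (viaUpElbow _ l′) = entersLeft-unique l l′
    leavesTop-unique (viaCrossing _ l b) (viaCrossing _ l′ b′) =
      cong₂ _⊔_ (entersLeft-unique l l′) (entersBottom-unique b b′)
    leavesTop-unique (viaVertical t _) (viaUpElbow t′ _) with () ← trans (sym t) t′
    leavesTop-unique (viaVertical t _) (viaCrossing t′ _ _) with () ← trans (sym t) t′
    leavesTop-unique (viaUpElbow t _) (viaVertical t′ _) with () ← trans (sym t) t′
    leavesTop-unique (viaUpElbow t _) (viaCrossing t′ _ _) with () ← trans (sym t) t′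
    leavesTop-unique (viaCrossing t _ _) (viaVertical t′ _) with () ← trans (sym t) t′
    leavesTop-unique (viaCrossing t _ _) (viaUpElbow t′ _) with () ← trans (sym t) t′

  ∂-unique : ∀ {i a b} → ∂ 𝒫 ⟦ i ⟧= a → ∂ 𝒫 ⟦ i ⟧= b → a ≡ b
  ∂-unique (_ , l , r) (_ , l′ , r′) with Last-unique l l′
  ... | refl = leavesRight-unique r r′

  -- Labels against columns

  mutual
    -- Labels start in their own column and move only north and east; passing a left edge has cost a
    -- step east, which makes this bound strict. The strictness later orders the two labels at a
    -- crossing outside `𝕐λ w`.
    entersLeft-bound : ∀ {i j a} → EntersLeft i j a → a < j
    entersLeft-bound {a = a} (fromLeft nx r) =
      subst (toℕ a ℕ.<_) (sym nx) (s≤s (leavesRight-bound r))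

    entersBottom-bound : ∀ {i j a} → EntersBottom i j a → a ≤ j
    entersBottom-bound (boundary _)    = ℕ.≤-refl
    entersBottom-bound (fromBelow _ u) = leavesTop-bound u

    leavesRight-bound : ∀ {i j a} → LeavesRight i j a → a ≤ j
    leavesRight-bound (viaHorizontal _ l) = ℕ.<⇒≤ (entersLeft-bound l)
    leavesRight-bound (viaDownElbow _ b)  = entersBottom-bound b
    leavesRight-bound (viaCrossing {a = x} {b = y} _ l b) =
      ℕ.≤-trans (Min.x⊓y≤y x y) (entersBottom-bound b)

    leavesTop-bound : ∀ {i j a} → LeavesTop i j a → a ≤ j
    leavesTop-bound (viaVertical _ b) = entersBottom-bound b
    leavesTop-bound (viaUpElbow _ l)  = ℕ.<⇒≤ (entersLeft-bound l)
    leavesTop-bound {j = j} (viaCrossing {a = x} {b = y} _ l b) =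
      Max.⊔-lub {x = j} {y = x} {z = y} (ℕ.<⇒≤ (entersLeft-bound l)) (entersBottom-bound b)

  -- The inequalities are weak because the two labels are not assumed distinct: equal labels may be
  -- read as passing straight or as bouncing.
  module Crossing {i j x y} (t : tile 𝒫 i j ≡ crossing)
                  (l : EntersLeft i j x) (b : EntersBottom i j y) where

    straight-right : x ≤ y → LeavesRight i j x
    straight-right x≤y = subst (LeavesRight i j) (Min.x≤y⇒x⊓y≈x x≤y) (viaCrossing t l b)

    straight-top : x ≤ y → LeavesTop i j y
    straight-top x≤y = subst (LeavesTop i j) (Max.x≤y⇒x⊔y≈y x≤y) (viaCrossing t l b)

    bounce-right : y ≤ x → LeavesRight i j y
    bounce-right y≤x = subst (LeavesRight i j) (Min.x≤y⇒y⊓x≈x y≤x) (viaCrossing t l b)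

    bounce-top : y ≤ x → LeavesTop i j x
    bounce-top y≤x = subst (LeavesTop i j) (Max.x≤y⇒y⊔x≈y y≤x) (viaCrossing t l b)

  open Crossing

  -- Following one label to its exit

  mutual
    traverse-left : ∀ {i j a} → Acc _>_ j → EntersLeft i j a →
                    (∃[ c ] (j ≤ c × LeavesTop i c a)) ⊎ ∂ 𝒫 ⟦ i ⟧= a
    traverse-left {a = a} aj l with left⁻¹ (entersLeft⇒left l)
    ... | inj₁ t        = weaken (traverse-right aj (viaHorizontal t l))
    ... | inj₂ (inj₁ t) = inj₁ (_ , ℕ.≤-refl , viaUpElbow t l)
    ... | inj₂ (inj₂ t) with labelBelow (cong bottom t)
    ...   | y , b with ≤-total a y
    ...     | inj₁ a≤y = weaken (traverse-right aj (straight-right t l b a≤y))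
    ...     | inj₂ y≤a = inj₁ (_ , ℕ.≤-refl , bounce-top t l b y≤a)

    traverse-right : ∀ {i j a} → Acc _>_ j → LeavesRight i j a →
                     (∃[ c ] (j < c × LeavesTop i c a)) ⊎ ∂ 𝒫 ⟦ i ⟧= a
    traverse-right {j = j} (acc rj) r with last⊎next j
    ... | inj₁ l         = inj₂ (_ , l , r)
    ... | inj₂ (j′ , nx) =
      ⊎-map₁ (λ (c , j′≤c , u) → c , ℕ.<-≤-trans (Next⇒< nx) j′≤c , u)
             (traverse-left (rj (Next⇒< nx)) (fromLeft nx r))

    weaken : ∀ {i j a} →
             (∃[ c ] (j < c × LeavesTop i c a)) ⊎ ∂ 𝒫 ⟦ i ⟧= a →
             (∃[ c ] (j ≤ c × LeavesTop i c a)) ⊎ ∂ 𝒫 ⟦ i ⟧= a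
    weaken = ⊎-map₁ (λ (c , j<c , u) → c , ℕ.<⇒≤ j<c , u)

  traverse-bottom : ∀ {i j a} → EntersBottom i j a →
                    (∃[ c ] (j ≤ c × LeavesTop i c a)) ⊎ ∂ 𝒫 ⟦ i ⟧= a
  traverse-bottom {a = a} b with bottom⁻¹ (entersBottom⇒bottom b)
  ... | inj₁ t        = inj₁ (_ , ℕ.≤-refl , viaVertical t b)
  ... | inj₂ (inj₁ t) = weaken (traverse-right (>-wellFounded _) (viaDownElbow t b))
  ... | inj₂ (inj₂ t) with labelLeft (cong left t)
  ...   | x , l with ≤-total x a
  ...     | inj₁ x≤a = inj₁ (_ , ℕ.≤-refl , straight-top t l b x≤a)
  ...     | inj₂ a≤x = weaken (traverse-right (>-wellFounded _) (bounce-right t l b a≤x))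

  mutual
    -- Each turn upwards leads to the row above, and no pipe meets the top boundary, so every label
    -- exits on the right in the end.
    exit-bottom : ∀ {i j a} → Acc _<_ i → EntersBottom i j a →
                  ∃[ i₁ ] (i₁ ≤ i × ∂ 𝒫 ⟦ i₁ ⟧= a)
    exit-bottom ai b with traverse-bottom b
    ... | inj₂ e           = _ , ℕ.≤-refl , e
    ... | inj₁ (_ , _ , u) with exit-top ai u
    ...   | i₁ , i₁<i , e = i₁ , ℕ.<⇒≤ i₁<i , e

    exit-top : ∀ {i j a} → Acc _<_ i → LeavesTop i j a →
               ∃[ i₁ ] (i₁ < i × ∂ 𝒫 ⟦ i₁ ⟧= a)
    exit-top {i} {j} (acc ri) u with first⊎prev i
    ... | inj₁ f         = contradiction (topEdge j f) (true≢false (leavesTop⇒top u))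
    ... | inj₂ (i₀ , nx) with exit-bottom (ri (Next⇒< nx)) (fromBelow nx u)
    ...   | i₁ , i₁≤i₀ , e = i₁ , ℕ.≤-<-trans i₁≤i₀ (Next⇒< nx) , e

  -- Two labels: a swap or a fixed exit order

  -- The condition `a < b` makes both labels go straight, so that they trade sides; otherwise they
  -- bounce.
  SwapAt : (a b : Fin n) → Cell n → Set
  SwapAt a b (i , j) = tile 𝒫 i j ≡ crossing × EntersLeft i j a × EntersBottom i j b × a < b

  -- The invariant carried from row to row, for `a` staying north-west of `b`.
  AheadAbove : (i a b : Fin n) → Set
  AheadAbove i a b = ∃[ c ] (LeavesTop i c a ×
    ((∃[ c′ ] (c < c′ × LeavesTop i c′ b)) ⊎ ∂ 𝒫 ⟦ i ⟧= b))

  aheadAbove : ∀ {i c q a b} → LeavesTop i c a → c < q → EntersBottom i q b → AheadAbove i a b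
  aheadAbove u c<q eb =
    _ , u , ⊎-map₁ (λ (c′ , q≤c′ , u′) → c′ , ℕ.<-≤-trans c<q q≤c′ , u′) (traverse-bottom eb)

  -- Two labels entering one cell force a crossing. If they bounce there, `a` goes up and `b` right,
  -- so `a` keeps its lead.
  meet : ∀ {i j a b} → EntersLeft i j a → EntersBottom i j b →
         SwapAt a b (i , j) ⊎ AheadAbove i a b
  meet {a = a} {b = b} l eb with left∧bottom⇒crossing (entersLeft⇒left l) (entersBottom⇒bottom eb)
  ... | t with a <? b
  ...   | yes a<b = inj₁ (t , l , eb , a<b)
  ...   | no  a≮b = inj₂ (_ , bounce-top t l eb b≤a ,
                            traverse-right (>-wellFounded _) (bounce-right t l eb b≤a))
    where b≤a = ℕ.≮⇒≥ a≮b

  mutual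
    -- While `b` waits below column `q`, `a` moves east along the row. Either it turns up before
    -- column `q`, or both enter the cell in that column and `meet` decides.
    approach-left : ∀ {i j q a b} → Acc _>_ j → EntersLeft i j a → j < q → EntersBottom i q b →
                    ∃ (SwapAt a b) ⊎ AheadAbove i a b
    approach-left {a = a} aj l j<q eb with left⁻¹ (entersLeft⇒left l)
    ... | inj₁ t        = approach-right aj (viaHorizontal t l) j<q eb
    ... | inj₂ (inj₁ t) = inj₂ (aheadAbove (viaUpElbow t l) j<q eb)
    ... | inj₂ (inj₂ t) with labelBelow (cong bottom t)
    ...   | y , b with ≤-total a y
    ...     | inj₁ a≤y = approach-right aj (straight-right t l b a≤y) j<q eb
    ...     | inj₂ y≤a = inj₂ (aheadAbove (bounce-top t l b y≤a) j<q eb)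

    approach-right : ∀ {i j q a b} → Acc _>_ j → LeavesRight i j a → j < q → EntersBottom i q b →
                     ∃ (SwapAt a b) ⊎ AheadAbove i a b
    approach-right {j = j} {q} (acc rj) r j<q eb with last⊎next j
    ... | inj₁ l         = contradiction j<q (ℕ.≤⇒≯ (Last⇒maximum l))
    ... | inj₂ (j′ , nx) with ℕ.m≤n⇒m<n∨m≡n (subst (ℕ._≤ toℕ q) (sym nx) j<q)
    ...   | inj₁ j′<q = approach-left (rj (Next⇒< nx)) (fromLeft nx r) j′<q eb
    ...   | inj₂ j′≡q with toℕ-injective j′≡q
    ...     | refl = ⊎-map₁ (λ s → _ , s) (meet (fromLeft nx r) eb)

  approach-bottom : ∀ {i p q a b} → EntersBottom i p a → p < q → EntersBottom i q b →
                    ∃ (SwapAt a b) ⊎ AheadAbove i a b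
  approach-bottom {a = a} ea p<q eb with bottom⁻¹ (entersBottom⇒bottom ea)
  ... | inj₁ t        = inj₂ (aheadAbove (viaVertical t ea) p<q eb)
  ... | inj₂ (inj₁ t) = approach-right (>-wellFounded _) (viaDownElbow t ea) p<q eb
  ... | inj₂ (inj₂ t) with labelLeft (cong left t)
  ...   | x , l with ≤-total x a
  ...     | inj₁ x≤a = inj₂ (aheadAbove (straight-top t l ea x≤a) p<q eb)
  ...     | inj₂ a≤x = approach-right (>-wellFounded _) (bounce-right t l ea a≤x) p<q eb

  ExitsAbove : (i a b : Fin n) → Set
  ExitsAbove i a b =
    ∃[ i₁ ] ∃[ i₂ ] (i₁ < i₂ × i₂ ≤ i × ∂ 𝒫 ⟦ i₁ ⟧= a × ∂ 𝒫 ⟦ i₂ ⟧= b)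

  mutual
    -- Induction upwards over the rows: without a swap, `a` enters each next row west of `b`. Once
    -- `b` exits, `a` has already gone up and must exit higher.
    swap⊎exitsAbove : ∀ {i p q a b} → Acc _<_ i → EntersBottom i p a → p < q → EntersBottom i q b →
                      ∃ (SwapAt a b) ⊎ ExitsAbove i a b
    swap⊎exitsAbove ai ea p<q eb with approach-bottom ea p<q eb
    ... | inj₁ s     = inj₁ s
    ... | inj₂ above = continueAbove ai above

    continueAbove : ∀ {i a b} → Acc _<_ i → AheadAbove i a b →
                    ∃ (SwapAt a b) ⊎ ExitsAbove i a b
    continueAbove ai (_ , u , inj₂ e) with exit-top ai u
    ... | i₁ , i₁<i , e₁ = inj₂ (i₁ , _ , i₁<i , ℕ.≤-refl , e₁ , e)
    continueAbove {i} (acc ri) (c , u , inj₁ (_ , c<c′ , u′)) with first⊎prev i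
    ... | inj₁ f         = contradiction (topEdge c f) (true≢false (leavesTop⇒top u))
    ... | inj₂ (i₀ , nx)
      with swap⊎exitsAbove (ri (Next⇒< nx)) (fromBelow nx u) c<c′ (fromBelow nx u′)
    ...   | inj₁ s                             = inj₁ s
    ...   | inj₂ (i₁ , i₂ , i₁<i₂ , i₂≤i₀ , es) =
      inj₂ (i₁ , i₂ , i₁<i₂ , ℕ.≤-trans i₂≤i₀ (ℕ.<⇒≤ (Next⇒< nx)) , es)

  -- The larger label leaves on top and the smaller one to the right, which is the starting position
  -- of `continueAbove` with the larger label ahead.
  crossing-inverts : ∀ {i j x y} → tile 𝒫 i j ≡ crossing → EntersLeft i j x → EntersBottom i j y →
                     ExitsAbove i (x ⊔ y) (x ⊓ y)
  crossing-inverts {x = x} {y} t l b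
    with continueAbove (<-wellFounded _)
           (_ , viaCrossing t l b , traverse-right (>-wellFounded _) (viaCrossing t l b))
  ... | inj₂ above = above
  -- A swap would need the maximum to be strictly smaller than the minimum.
  ... | inj₁ (_ , _ , _ , _ , x⊔y<x⊓y) =
    contradiction (ℕ.<-≤-trans x⊔y<x⊓y (Min.x⊓y≤x x y)) (ℕ.≤⇒≯ (Max.x≤x⊔y x y))

-- Decidability and injectivity

-- `Vexillary` is a negation, so its failure is a double negation; decidability recovers an actual
-- pattern from it.
contains2143? : ∀ {n} → Decidable (Contains2143 {n})
contains2143? w = any? λ i₁ → any? λ i₂ → any? λ i₃ → any? λ i₄ →
  i₁ <? i₂ ×-dec i₂ <? i₃ ×-dec i₃ <? i₄ ×-dec
  w ⟨$⟩ʳ i₂ <? w ⟨$⟩ʳ i₁ ×-dec w ⟨$⟩ʳ i₁ <? w ⟨$⟩ʳ i₄ ×-dec w ⟨$⟩ʳ i₄ <? w ⟨$⟩ʳ i₃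

-- Allows a crossing to be located in `𝕐λ w` by refuting that it lies outside.
𝕐λ? : ∀ {n} (w : Permutation′ n) → Decidable (𝕐λ w)
𝕐λ? w (i , j) = any? λ a → any? λ b →
  (b <? w ⟨$⟩ʳ a ×-dec a <? w ⟨$⟩ˡ b) ×-dec i ≤? a ×-dec j ≤? b

⟨$⟩ʳ-injective : ∀ {n} (w : Permutation′ n) {i j} → w ⟨$⟩ʳ i ≡ w ⟨$⟩ʳ j → i ≡ j
⟨$⟩ʳ-injective w eq = trans (sym (inverseˡ w)) (trans (cong (w ⟨$⟩ˡ_) eq) (inverseˡ w))

-- From a crossing inside `𝕐λ w` to a 2143 pattern

module _ {n : ℕ} (w : Permutation′ n) (𝒫 : BPD n) (𝒫∈ : 𝒫 ∈ Pipes w) where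
  open BPD 𝒫 hiding (tile)
  open Edges 𝒫
  open Propagation 𝒫 demazure

  exit-label : ∀ {i a} → ∂ 𝒫 ⟦ i ⟧= a → w ⟨$⟩ʳ i ≡ a
  exit-label {i} = ∂-unique 𝒫 (𝒫∈ i)

  crossing-in-𝕐λ⇒contains2143 : HasCrossingIn 𝒫 (𝕐λ w) → Contains2143 w
  crossing-in-𝕐λ⇒contains2143 (i , j , (a , b , (b<wa , a<w⁻¹b) , i≤a , j≤b) , t)
    with labelLeft 𝒫 (cong left t) | labelBelow 𝒫 (cong bottom t)
  ... | x , l | y , d with crossing-inverts 𝒫 t l d
  ... | i₁ , i₂ , i₁<i₂ , i₂≤i , e₁ , e₂ =
    -- The larger label of the crossing exits in row `i₁`, the smaller in row `i₂`; the other two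
    -- rows come from the diagram cell `(a , b)`.
    i₁ , i₂ , a , w ⟨$⟩ˡ b , i₁<i₂ , i₂<a , a<w⁻¹b , wi₂<wi₁ , wi₁<ww⁻¹b ,
    subst (_< w ⟨$⟩ʳ a) (sym (inverseʳ w)) b<wa
    where
    wi₁≤b : w ⟨$⟩ʳ i₁ ≤ b
    wi₁≤b = subst (_≤ b) (sym (exit-label e₁))
      (ℕ.≤-trans (leavesTop-bound 𝒫 (viaCrossing t l d)) j≤b)

    -- Strict because the exit rows differ and `w` is injective.
    wi₂<wi₁ : w ⟨$⟩ʳ i₂ < w ⟨$⟩ʳ i₁
    wi₂<wi₁ = ℕ.≤∧≢⇒<
      (subst₂ _≤_ (sym (exit-label e₂)) (sym (exit-label e₁))
        (ℕ.≤-trans (Min.x⊓y≤x x y) (Max.x≤x⊔y x y)))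
      (λ eq → ℕ.<-irrefl (cong toℕ (⟨$⟩ʳ-injective w (toℕ-injective (sym eq)))) i₁<i₂)

    -- If `i₂` were `a`, then w a < w i₁ ≤ b, against `b<wa`.
    i₂<a : i₂ < a
    i₂<a = ℕ.≤∧≢⇒< (ℕ.≤-trans i₂≤i i≤a) λ i₂≡a →
      ℕ.<-asym b<wa (subst (λ k → w ⟨$⟩ʳ k < b) (toℕ-injective i₂≡a) (ℕ.<-≤-trans wi₂<wi₁ wi₁≤b))

    -- If w i₁ were b, then i₁ = w⁻¹ b > a, although i₁ < i₂ < a.
    wi₁<ww⁻¹b : w ⟨$⟩ʳ i₁ < w ⟨$⟩ʳ (w ⟨$⟩ˡ b)
    wi₁<ww⁻¹b = ℕ.≤∧≢⇒< (subst (w ⟨$⟩ʳ i₁ ≤_) (sym (inverseʳ w)) wi₁≤b) λ eq →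
      ℕ.<-asym a<w⁻¹b
        (subst (_< a) (⟨$⟩ʳ-injective w (toℕ-injective eq)) (ℕ.<-trans i₁<i₂ i₂<a))

  -- Agreement with the Rothe bumpless pipe dream of w, in which the pipe w i
  -- runs along row i from column w i on, and along column w i below row i.
  RightAgrees BottomAgrees LeftAgrees TopAgrees : (i j : Fin n) → Set
  RightAgrees  i j = (right (tile 𝒫 i j) ≡ true ⇔ w ⟨$⟩ʳ i ≤ j) ×
                     (∀ {a} → LeavesRight i j a → a ≡ w ⟨$⟩ʳ i)
  BottomAgrees i j = (bottom (tile 𝒫 i j) ≡ true ⇔ w ⟨$⟩ˡ j ≤ i) ×
                     (∀ {a} → EntersBottom i j a → a ≡ j)
  LeftAgrees   i j = (left (tile 𝒫 i j) ≡ true ⇔ w ⟨$⟩ʳ i < j) ×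
                     (∀ {a} → EntersLeft i j a → a ≡ w ⟨$⟩ʳ i)
  TopAgrees    i j = (top (tile 𝒫 i j) ≡ true ⇔ w ⟨$⟩ˡ j < i) ×
                     (∀ {a} → LeavesTop i j a → a ≡ j)

  -- If neither the right nor the bottom edge is met, `(i , j)` is a diagram cell; if just one is,
  -- the tile is horizontal or vertical. If both are, labels separate the two candidates: a downward
  -- elbow sends `j` right, so w i = j, while a crossing receives a label below `j` from the left,
  -- so w i < j.
  agrees-step : ∀ {i j} → ¬ RotheDiagram w (i , j) → RightAgrees i j → BottomAgrees i j →
                LeftAgrees i j × TopAgrees i j
  agrees-step {i} {j} ∉D (right⇔ , right-label) (bottom⇔ , bottom-label) = go _ refl
    where
    present : ∀ {b} {P : Set} → b ≡ true → P → (b ≡ true ⇔ P)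
    present b p = mk⇔ (λ _ → p) (λ _ → b)

    absent : ∀ {b} {P : Set} → b ≡ false → ¬ P → (b ≡ true ⇔ P)
    absent f ¬p = mk⇔ (λ b → contradiction f (true≢false b)) (λ p → contradiction p ¬p)

    ¬left : left (tile 𝒫 i j) ≡ false → ∀ {a} → EntersLeft i j a → a ≡ w ⟨$⟩ʳ i
    ¬left f l = contradiction f (true≢false (entersLeft⇒left l))

    ¬top : top (tile 𝒫 i j) ≡ false → ∀ {a} → LeavesTop i j a → a ≡ j
    ¬top f u = contradiction f (true≢false (leavesTop⇒top u))

    wi≰j : right (tile 𝒫 i j) ≡ false → ¬ (w ⟨$⟩ʳ i ≤ j)
    wi≰j f wi≤j = true≢false (Equivalence.from right⇔ wi≤j) f

    w⁻¹j≰i : bottom (tile 𝒫 i j) ≡ false → ¬ (w ⟨$⟩ˡ j ≤ i)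
    w⁻¹j≰i f w⁻¹j≤i = true≢false (Equivalence.from bottom⇔ w⁻¹j≤i) f

    no-gap : right (tile 𝒫 i j) ≡ false → bottom (tile 𝒫 i j) ≡ false →
             LeftAgrees i j × TopAgrees i j
    no-gap ¬r ¬b = contradiction (ℕ.≰⇒> (wi≰j ¬r) , ℕ.≰⇒> (w⁻¹j≰i ¬b)) ∉D

    wi≡j⇒w⁻¹j≡i : w ⟨$⟩ʳ i ≡ j → w ⟨$⟩ˡ j ≡ i
    wi≡j⇒w⁻¹j≡i refl = inverseˡ w

    w⁻¹j≡i⇒wi≡j : w ⟨$⟩ˡ j ≡ i → w ⟨$⟩ʳ i ≡ j
    w⁻¹j≡i⇒wi≡j refl = inverseʳ w

    go : ∀ t → tile 𝒫 i j ≡ t → LeftAgrees i j × TopAgrees i j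
    go blank   t = no-gap (cong right t) (cong bottom t)
    go upElbow t = no-gap (cong right t) (cong bottom t)
    go horizontal t =
      (present (cong left t) wi<j , λ l → right-label (viaHorizontal t l)) ,
      (absent (cong top t) (w⁻¹j≰i (cong bottom t) ∘ ℕ.<⇒≤) , ¬top (cong top t))
      where
      -- Equality would give w⁻¹ j = i, and the bottom edge would be met.
      wi<j : w ⟨$⟩ʳ i < j
      wi<j = ℕ.≤∧≢⇒< (Equivalence.to right⇔ (cong right t)) λ eq →
        w⁻¹j≰i (cong bottom t) (ℕ.≤-reflexive (cong toℕ (wi≡j⇒w⁻¹j≡i (toℕ-injective eq))))
    go vertical t =
      (absent (cong left t) (wi≰j (cong right t) ∘ ℕ.<⇒≤) , ¬left (cong left t)) ,
      (present (cong top t) w⁻¹j<i , label)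
      where
      w⁻¹j<i : w ⟨$⟩ˡ j < i
      w⁻¹j<i = ℕ.≤∧≢⇒< (Equivalence.to bottom⇔ (cong bottom t)) λ eq →
        wi≰j (cong right t) (ℕ.≤-reflexive (cong toℕ (w⁻¹j≡i⇒wi≡j (toℕ-injective eq))))

      label : ∀ {a} → LeavesTop i j a → a ≡ j
      label u with labelBelow 𝒫 (cong bottom t)
      ... | _ , b = trans (leavesTop-unique 𝒫 u (viaVertical t b)) (bottom-label b)
    go downElbow t =
      (absent (cong left t) (ℕ.<-irrefl (cong toℕ wi≡j)) , ¬left (cong left t)) ,
      (absent (cong top t) (ℕ.<-irrefl (cong toℕ (wi≡j⇒w⁻¹j≡i wi≡j))) , ¬top (cong top t))
      where
      wi≡j : w ⟨$⟩ʳ i ≡ j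
      wi≡j with labelBelow 𝒫 (cong bottom t)
      ... | _ , b = trans (sym (right-label (viaDownElbow t b))) (bottom-label b)
    go crossing t with labelLeft 𝒫 (cong left t) | labelBelow 𝒫 (cong bottom t)
    ... | _ , l | _ , b with bottom-label b
    ... | refl =
      (present (cong left t) wi<j , left-label) ,
      (present (cong top t) w⁻¹j<i ,
        λ u → leavesTop-unique 𝒫 u (straight-top t l b (ℕ.<⇒≤ (entersLeft-bound 𝒫 l))))
      where
      open Crossing 𝒫

      -- A label from the left is below `j`, so it passes straight to the right edge, whose label is
      -- known.
      left-label : ∀ {a} → EntersLeft i j a → a ≡ w ⟨$⟩ʳ i
      left-label l′ = right-label (straight-right t l′ b (ℕ.<⇒≤ (entersLeft-bound 𝒫 l′)))

      wi<j : w ⟨$⟩ʳ i < j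
      wi<j = subst (_< j) (left-label l) (entersLeft-bound 𝒫 l)

      w⁻¹j<i : w ⟨$⟩ˡ j < i
      w⁻¹j<i = ℕ.≤∧≢⇒< (Equivalence.to bottom⇔ (cong bottom t)) λ eq →
        ℕ.<-irrefl (cong toℕ (w⁻¹j≡i⇒wi≡j (toℕ-injective eq))) wi<j

  -- Agreement with the Rothe bumpless pipe dream outside `𝕐λ w`

  𝕐λ-down : ∀ {i j i′ j′} → i ≤ i′ → j ≤ j′ → (i′ , j′) ∈ 𝕐λ w → (i , j) ∈ 𝕐λ w
  𝕐λ-down i≤i′ j≤j′ (a , b , ab∈D , i′≤a , j′≤b) =
    a , b , ab∈D , ℕ.≤-trans i≤i′ i′≤a , ℕ.≤-trans j≤j′ j′≤b

  RotheDiagram⊆𝕐λ : ∀ {i j} → RotheDiagram w (i , j) → (i , j) ∈ 𝕐λ w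
  RotheDiagram⊆𝕐λ ij∈D = _ , _ , ij∈D , ℕ.≤-refl , ℕ.≤-refl

  mutual
    -- Induction from the south-east corner, which never re-enters `𝕐λ w`. The right edge of a cell
    -- is the left edge of the next, and the column shift turns w i < j′ into w i ≤ j.
    right-agrees : ∀ {i j} → Acc _>_ i → Acc _>_ j → ¬ (i , j) ∈ 𝕐λ w → RightAgrees i j
    right-agrees {i} ai (acc rj) ∉Y with last⊎next _
    -- On the right boundary, agreement of labels is the hypothesis `𝒫∈`.
    ... | inj₁ l =
      mk⇔ (λ _ → Last⇒maximum l) (λ _ → rightEdge i l) , λ r → sym (exit-label (_ , l , r))
    ... | inj₂ (j′ , nx)
      with agrees ai (rj (Next⇒< nx)) (∉Y ∘ 𝕐λ-down ℕ.≤-refl (ℕ.<⇒≤ (Next⇒< nx)))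
    ...   | (left⇔ , left-label) , _ =
      mk⇔ (λ r → s≤s⁻¹ (subst (suc (toℕ (w ⟨$⟩ʳ i)) ℕ.≤_) nx
                         (Equivalence.to left⇔ (trans (sym (matchRow i nx)) r))))
          (λ wi≤j → trans (matchRow i nx)
            (Equivalence.from left⇔ (ℕ.≤-<-trans wi≤j (Next⇒< nx)))) ,
      λ r → left-label (fromLeft nx r)

    bottom-agrees : ∀ {i j} → Acc _>_ i → Acc _>_ j → ¬ (i , j) ∈ 𝕐λ w → BottomAgrees i j
    bottom-agrees {i} {j} (acc ri) aj ∉Y with last⊎next i
    ... | inj₁ l =
      mk⇔ (λ _ → Last⇒maximum l) (λ _ → bottomEdge j l) ,
      λ b → entersBottom-unique 𝒫 b (boundary l)
    ... | inj₂ (i′ , nx)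
      with agrees (ri (Next⇒< nx)) aj (∉Y ∘ 𝕐λ-down (ℕ.<⇒≤ (Next⇒< nx)) ℕ.≤-refl)
    ...   | _ , top⇔ , top-label =
      mk⇔ (λ b → s≤s⁻¹ (subst (suc (toℕ (w ⟨$⟩ˡ j)) ℕ.≤_) nx
                         (Equivalence.to top⇔ (trans (sym (matchColumn j nx)) b))))
          (λ w⁻¹j≤i → trans (matchColumn j nx)
            (Equivalence.from top⇔ (ℕ.≤-<-trans w⁻¹j≤i (Next⇒< nx)))) ,
      λ { (boundary _)     → refl
        ; (fromBelow nx′ u) → top-label
            (subst (λ k → LeavesTop k j _) (toℕ-injective (trans nx′ (sym nx))) u) }

    agrees : ∀ {i j} → Acc _>_ i → Acc _>_ j → ¬ (i , j) ∈ 𝕐λ w →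
             LeftAgrees i j × TopAgrees i j
    agrees ai aj ∉Y =
      agrees-step (∉Y ∘ RotheDiagram⊆𝕐λ) (right-agrees ai aj ∉Y) (bottom-agrees ai aj ∉Y)

  crossing-outside-𝕐λ : ∀ {i j x y} → ¬ (i , j) ∈ 𝕐λ w → EntersLeft i j x → EntersBottom i j y →
                        x ≡ w ⟨$⟩ʳ i × y ≡ j × x < y
  crossing-outside-𝕐λ ∉Y l b with proj₂ (bottom-agrees (>-wellFounded _) (>-wellFounded _) ∉Y) b
  ... | refl =
    proj₂ (proj₁ (agrees (>-wellFounded _) (>-wellFounded _) ∉Y)) l ,
    refl , entersLeft-bound 𝒫 l

  -- From a 2143 pattern to a crossing inside `𝕐λ w`

  contains2143⇒crossing-in-𝕐λ : Contains2143 w → HasCrossingIn 𝒫 (𝕐λ w)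
  contains2143⇒crossing-in-𝕐λ
    (i₁ , i₂ , i₃ , i₄ , i₁<i₂ , i₂<i₃ , i₃<i₄ , wi₂<wi₁ , wi₁<wi₄ , wi₄<wi₃)
    with some-last i₁
  ... | _ , last
    -- On the bottom boundary labels are columns, so w i₂ starts west of w i₁. Without a swap it
    -- would exit above w i₁, against `i₁<i₂`.
    with swap⊎exitsAbove 𝒫 (<-wellFounded _) (boundary last) wi₂<wi₁ (boundary last)
  ... | inj₂ (k₁ , k₂ , k₁<k₂ , _ , e₁ , e₂) = contradiction i₁<i₂
    (ℕ.<-asym (subst₂ _<_ (⟨$⟩ʳ-injective w (exit-label e₁)) (⟨$⟩ʳ-injective w (exit-label e₂)) k₁<k₂))
  ... | inj₁ ((i , j) , t , l , b , _) = i , j , decidable-stable (𝕐λ? w (i , j)) ¬¬∈Y , t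
    where
    ¬¬∈Y : ¬ ¬ (i , j) ∈ 𝕐λ w
    ¬¬∈Y ∉Y with crossing-outside-𝕐λ ∉Y l b
    ... | wi₂≡wi , refl , _ with ⟨$⟩ʳ-injective w wi₂≡wi
    -- The swap is now in row `i₂` and column w i₁, weakly north-west of the diagram cell (i₃, w
    -- i₄).
    ...   | refl = ∉Y (i₃ , w ⟨$⟩ʳ i₄ ,
      (wi₄<wi₃ , subst (i₃ <_) (sym (inverseˡ w)) i₃<i₄) , ℕ.<⇒≤ i₂<i₃ , ℕ.<⇒≤ wi₁<wi₄)

  -- Reducedness in the vexillary case

  module _ (vex : Vexillary w) where
    private
      module Straight = Propagation 𝒫 straight
      open Crossing 𝒫

    vexillary⇒crossing-labels : ∀ {i j x y} → tile 𝒫 i j ≡ crossing →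
      EntersLeft i j x → EntersBottom i j y → x ≡ w ⟨$⟩ʳ i × y ≡ j × x < y
    vexillary⇒crossing-labels t =
      crossing-outside-𝕐λ λ ∈Y → vex (crossing-in-𝕐λ⇒contains2143 (_ , _ , ∈Y , t))

    vexillary⇒crossing-straight : ∀ {i j x y} → tile 𝒫 i j ≡ crossing →
      EntersLeft i j x → EntersBottom i j y → LeavesRight i j x × LeavesTop i j y
    vexillary⇒crossing-straight t l b with vexillary⇒crossing-labels t l b
    ... | _ , _ , x<y = straight-right t l b (ℕ.<⇒≤ x<y) , straight-top t l b (ℕ.<⇒≤ x<y)

    mutual
      -- `Reduced` speaks of actual pipes, the agreement above of Demazure labels; as no crossing
      -- bounces, the first labelling is contained in the second.
      straight⇒demazureLeft : ∀ {i j a} → Straight.EntersLeft i j a → EntersLeft i j a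
      straight⇒demazureLeft (Straight.fromLeft nx r) = fromLeft nx (straight⇒demazureRight r)

      straight⇒demazureBottom : ∀ {i j a} → Straight.EntersBottom i j a → EntersBottom i j a
      straight⇒demazureBottom (Straight.boundary l)     = boundary l
      straight⇒demazureBottom (Straight.fromBelow nx u) = fromBelow nx (straight⇒demazureTop u)

      straight⇒demazureRight : ∀ {i j a} → Straight.LeavesRight i j a → LeavesRight i j a
      straight⇒demazureRight (Straight.viaHorizontal t l) = viaHorizontal t (straight⇒demazureLeft l)
      straight⇒demazureRight (Straight.viaDownElbow t b)  = viaDownElbow t (straight⇒demazureBottom b)
      straight⇒demazureRight (Straight.viaCrossing t l b) = proj₁
        (vexillary⇒crossing-straight t (straight⇒demazureLeft l) (straight⇒demazureBottom b))

      straight⇒demazureTop : ∀ {i j a} → Straight.LeavesTop i j a → LeavesTop i j a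
      straight⇒demazureTop (Straight.viaVertical t b) = viaVertical t (straight⇒demazureBottom b)
      straight⇒demazureTop (Straight.viaUpElbow t l)  = viaUpElbow t (straight⇒demazureLeft l)
      straight⇒demazureTop (Straight.viaCrossing t l b) = proj₂
        (vexillary⇒crossing-straight t (straight⇒demazureLeft l) (straight⇒demazureBottom b))

    straight-crossing : ∀ {i j x y} → tile 𝒫 i j ≡ crossing →
      Straight.EntersLeft i j x → Straight.EntersBottom i j y → x ≡ w ⟨$⟩ʳ i × y ≡ j × x < y
    straight-crossing t l b =
      vexillary⇒crossing-labels t (straight⇒demazureLeft l) (straight⇒demazureBottom b)

    straight-order : ∀ {i j x y} → tile 𝒫 i j ≡ crossing →
      Straight.EntersLeft i j x → Straight.EntersBottom i j y → x < y
    straight-order t l b = proj₂ (proj₂ (straight-crossing t l b))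

    -- The smaller label fixes the row by injectivity of `w`, and the larger one is the column.
    crossing-cell-unique : ∀ {i j i′ j′ p q : Fin n} →
      p ≡ w ⟨$⟩ʳ i × q ≡ j × p < q → p ≡ w ⟨$⟩ʳ i′ × q ≡ j′ × p < q → (i , j) ≡ (i′ , j′)
    crossing-cell-unique (p≡wi , q≡j , _) (p≡wi′ , q≡j′ , _) =
      cong₂ _,_ (⟨$⟩ʳ-injective w (trans (sym p≡wi) p≡wi′)) (trans (sym q≡j) q≡j′)

    vexillary⇒reduced : Reduced 𝒫
    vexillary⇒reduced p q _ _ _ (t , inj₁ (l , b)) (t′ , inj₁ (l′ , b′)) =
      crossing-cell-unique (straight-crossing t l b) (straight-crossing t′ l′ b′)
    vexillary⇒reduced p q _ _ _ (t , inj₂ (l , b)) (t′ , inj₂ (l′ , b′)) =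
      crossing-cell-unique (straight-crossing t l b) (straight-crossing t′ l′ b′)
    -- Entering from opposite sides at the two cells would give both p < q and q < p.
    vexillary⇒reduced p q _ _ _ (t , inj₁ (l , b)) (t′ , inj₂ (l′ , b′)) = contradiction
      (straight-order t l b) (ℕ.<-asym (straight-order t′ l′ b′))
    vexillary⇒reduced p q _ _ _ (t , inj₂ (l , b)) (t′ , inj₁ (l′ , b′)) = contradiction
      (straight-order t l b) (ℕ.<-asym (straight-order t′ l′ b′))

lemma7p2 : (n : ℕ) (w : Permutation′ n) →
    ((𝒫 : BPD n) → 𝒫 ∈ Pipes w → (HasCrossingIn 𝒫 (𝕐λ w) ⇔ (¬ Vexillary w)))
    × (Vexillary w → RPipes w ≐ Pipes w)
lemma7p2 n w =
  (λ 𝒫 𝒫∈ → mk⇔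
    (λ c vex → vex (crossing-in-𝕐λ⇒contains2143 w 𝒫 𝒫∈ c))
    (λ ¬vex → contains2143⇒crossing-in-𝕐λ w 𝒫 𝒫∈ (decidable-stable (contains2143? w) ¬vex))) ,
  λ vex → proj₁ , λ {𝒫} 𝒫∈ → 𝒫∈ , vexillary⇒reduced w 𝒫 𝒫∈ vex
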